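{- Let $V$ be a finite-dimensional real vector space and $X\subseteq V$ a finite or countable set such that every $2$-dimensional linear subset of $X$ has fundamental vectors, and suppose $X$ has a suitable ordering $\gamma_1,\gamma_2,\ldots$ with initial segments $X_i=\{\gamma_1,\ldots,\gamma_i\}$. Let $X_m$ be an initial segment and let $U$ be coclosed in $X_m$. Let $\overline{U}$ be the closure of $U$ in $X$. Then $\overline{U}$ is biclosed in $X$.
   Context: $\mathrm{Span}_+(A)$ denotes nonnegative linear combinations. For $Y\subseteq X$ and $B\subseteq Y$: $B$ is closed in $Y$ if $\alpha,\beta\in B$ and $\gamma\in\mathrm{Span}_+(\alpha,\beta)\cap Y$ imply $\gamma\in B$; coclosed in $Y$ if $Y\setminus B$ is closed in $Y$; biclosed if both; weakly separable in $Y$ if $\mathrm{Span}_+(B)\cap\mathrm{Span}_+(Y\setminus B)=\{0\}$. A set $Y$ is clean if every subset biclosed in $Y$ is weakly separable in $Y$. The closure of $U$ in $X$ is the smallest subset of $X$ containing $U$ and closed in $X$. A linear subset of $X$ is $X\cap L$ for a linear subspace $L$; its dimension is $\dim\mathrm{Span}_\mathbb{R}$. A $2$-dimensional linear subset $Y$ has fundamental vectors if there are $\alpha,\beta\in Y$ with $Y\subseteq\mathrm{Span}_+\{\alpha,\beta\}$, $\alpha\notin\mathrm{Span}_+(Y\setminus\{\alpha\})$ and $\beta\notin\mathrm{Span}_+(Y\setminus\{\beta\})$. A subset $F\subseteq X$ is full if for all $\alpha,\beta\in F$, $F\cap\mathrm{Span}\{\alpha,\beta\}=X\cap\mathrm{Span}\{\alpha,\beta\}$.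 An ordering $\gamma_1,\gamma_2,\ldots$ of $X$ is suitable if (1) in every $2$-dimensional linear subset of $X$, the fundamental vectors come before all other vectors of that subset, and (2) for every index $i$ and any $\alpha,\beta,\gamma\in X_i$, there is a full subset $F\subseteq X$ containing $\{\alpha,\beta,\gamma\}$ such that $F\cap X_i$ is clean.
   Formalization: The formal theorem additionally assumes that 0 is not in X; without this the claim fails, e.g. for X = {e1, e2, 0} in the plane in this order and U = {e1}, whose closure {e1, 0} is not coclosed in X. -}

module Defs where

open import Algebra.Bundles using (CommutativeRing)
open import Algebra.Definitions.RawMonoid using (sum)
open import Algebra.Module.Bundles using (Module)
open import Data.Fin.Base using (Fin; toℕ)
open import Data.Nat.Base as ℕ using (ℕ)
open import Data.Product.Base using (∃; ∃-syntax; _×_; _,_; proj₁; proj₂)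
open import Data.Sum.Base using (_⊎_; inj₁; inj₂)
open import Data.Vec.Functional using (Vector)
open import Function.Base using (id)
open import Function.Bundles using (_⇔_)
open import Level using (Level; suc)
open import Relation.Binary.Core using (Rel)
open import Relation.Binary.Definitions using (_Respects_)
open import Relation.Binary.PropositionalEquality.Core using (_≡_)
open import Relation.Binary.Structures using (IsTotalOrder)
open import Relation.Nullary.Negation.Core using (¬_)
open import Relation.Unary using (Pred; _∈_; _∉_; _⊆_; _≐_; _∩_; _∖_; U)

-- The real numbers, given axiomatically: a Dedekind-complete ordered field
-- (unique up to isomorphism, classically).

record RealField (ℓ : Level) : Set (suc ℓ) where
  infix 4 _≤_
  field
    commutativeRing : CommutativeRing ℓ ℓ

  open CommutativeRing commutativeRing public

  field
    _≤_          : Rel Carrier ℓ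
    isTotalOrder : IsTotalOrder _≈_ _≤_
    0≉1          : ¬ 0# ≈ 1#
    inverse      : ∀ x → ¬ x ≈ 0# → ∃[ y ] x * y ≈ 1#
    +-monoˡ-≤    : ∀ z {x y} → x ≤ y → x + z ≤ y + z
    *-nonneg     : ∀ {x y} → 0# ≤ x → 0# ≤ y → 0# ≤ x * y

  IsUpperBound : Pred Carrier ℓ → Pred Carrier ℓ
  IsUpperBound S b = ∀ x → x ∈ S → x ≤ b

  field
    supremum : ∀ S → ∃ S → ∃ (IsUpperBound S) →
               ∃[ s ] IsUpperBound S s × (∀ b → IsUpperBound S b → s ≤ b)

-- Index sets of finite and of countably infinite enumerations.

data Length : Set where
  finite   : ℕ → Length
  infinite : Length

Index : Length → Set
Index (finite n) = Fin n
Index infinite   = ℕ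

position : ∀ {N} → Index N → ℕ
position {finite n} = toℕ
position {infinite} = id

module _ {ℓ : Level} (ℝ : RealField ℓ)
         (V : Module (RealField.commutativeRing ℝ) ℓ ℓ) where

  open RealField ℝ using (0#; _≈_; _≤_) renaming (Carrier to Scalar)
  open Module V

  -- Plain predicates, not required to respect _≈ᴹ_: the notions below force
  -- this where it matters, e.g. a set closed in Y respects _≈ᴹ_ inside Y
  -- because v ≈ᴹ w puts w in Span₊ ｛ v ⨾ v ｝.
  Subset : Set (suc ℓ)
  Subset = Pred Carrierᴹ ℓ

  -- Relation.Unary.｛_｝ uses propositional equality instead of _≈ᴹ_.
  ｛_｝ : Carrierᴹ → Subset
  ｛ α ｝ v = v ≈ᴹ α

  ｛_⨾_｝ : Carrierᴹ → Carrierᴹ → Subset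
  ｛ α ⨾ β ｝ v = v ≈ᴹ α ⊎ v ≈ᴹ β

  ∑ : ∀ {n} → Vector Scalar n → Vector Carrierᴹ n → Carrierᴹ
  ∑ c a = sum +ᴹ-rawMonoid (λ i → c i *ₗ a i)

  Span : Subset → Subset
  Span A v = ∃[ n ] ∃[ c ] ∃[ a ]
    (∀ (i : Fin n) → a i ∈ A) × v ≈ᴹ ∑ c a

  Span₊ : Subset → Subset
  Span₊ A v = ∃[ n ] ∃[ c ] ∃[ a ]
    (∀ (i : Fin n) → a i ∈ A) × (∀ i → 0# ≤ c i) × v ≈ᴹ ∑ c a

  LinearlyIndependent : ∀ {n} → Vector Carrierᴹ n → Set ℓ
  LinearlyIndependent b = ∀ c → ∑ c b ≈ᴹ 0ᴹ → ∀ i → c i ≈ 0#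

  -- Intended for subspaces S.
  HasDimension : ∀ {a} → Pred Carrierᴹ a → ℕ → Set _
  HasDimension S n = ∃[ b ]
    (∀ (i : Fin n) → b i ∈ S) × LinearlyIndependent b ×
    (∀ v → v ∈ S → ∃[ c ] v ≈ᴹ ∑ c b)

  FiniteDimensional : Set ℓ
  FiniteDimensional = ∃[ n ] HasDimension U n

  record IsSubspace (L : Subset) : Set ℓ where
    field
      resp      : L Respects _≈ᴹ_
      0-closed  : 0ᴹ ∈ L
      +-closed  : ∀ {v w} → v ∈ L → w ∈ L → v +ᴹ w ∈ L
      *ₗ-closed : ∀ x {v} → v ∈ L → x *ₗ v ∈ L

  Closed : (Y B : Subset) → Set ℓ
  Closed Y B = B ⊆ Y ×
    (∀ α β γ → α ∈ B → β ∈ B → γ ∈ Span₊ ｛ α ⨾ β ｝ ∩ Y → γ ∈ B)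

  Coclosed : (Y B : Subset) → Set ℓ
  Coclosed Y B = B ⊆ Y × Closed Y (Y ∖ B)

  Biclosed : (Y B : Subset) → Set ℓ
  Biclosed Y B = Closed Y B × Coclosed Y B

  WeaklySeparable : (Y B : Subset) → Set ℓ
  WeaklySeparable Y B = Span₊ B ∩ Span₊ (Y ∖ B) ≐ ｛ 0ᴹ ｝

  Clean : Subset → Set (suc ℓ)
  Clean Y = ∀ B → Biclosed Y B → WeaklySeparable Y B

  record IsClosure (X A Ā : Subset) : Set (suc ℓ) where
    field
      contains : A ⊆ Ā
      closed   : Closed X Ā
      smallest : ∀ C → A ⊆ C → Closed X C → Ā ⊆ C

  data Generated (X A : Subset) : Subset where
    generator : ∀ {v} → v ∈ A → Generated X A v
    combine   : ∀ {α β γ} → Generated X A α → Generated X A β →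
                γ ∈ Span₊ ｛ α ⨾ β ｝ ∩ X → Generated X A γ

  closure-exists : ∀ X A → A ⊆ X → IsClosure X A (Generated X A)
  closure-exists X A A⊆X = record
    { contains = generator
    ; closed   = within , λ α β γ → combine
    ; smallest = λ C A⊆C C-closed → least C A⊆C (proj₂ C-closed)
    }
    where
    within : Generated X A ⊆ X
    within (generator v∈A) = A⊆X v∈A
    within (combine _ _ p) = proj₂ p

    least : ∀ C → A ⊆ C →
            (∀ α β γ → α ∈ C → β ∈ C → γ ∈ Span₊ ｛ α ⨾ β ｝ ∩ X → γ ∈ C) →
            Generated X A ⊆ C
    least C A⊆C step (generator v∈A) = A⊆C v∈A
    least C A⊆C step (combine p q r) =
      step _ _ _ (least C A⊆C step p) (least C A⊆C step q) r

  LinearSubset : (X Y : Subset) → Set (suc ℓ)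
  LinearSubset X Y = ∃[ L ] IsSubspace L × Y ≐ X ∩ L

  TwoDimensionalLinearSubset : (X Y : Subset) → Set (suc ℓ)
  TwoDimensionalLinearSubset X Y = LinearSubset X Y × HasDimension (Span Y) 2

  FundamentalVectors : Subset → Carrierᴹ → Carrierᴹ → Set ℓ
  FundamentalVectors Y α β =
    α ∈ Y × β ∈ Y × Y ⊆ Span₊ ｛ α ⨾ β ｝ ×
    α ∉ Span₊ (Y ∖ ｛ α ｝) × β ∉ Span₊ (Y ∖ ｛ β ｝)

  HasFundamentalVectors : Subset → Set ℓ
  HasFundamentalVectors Y = ∃[ α ] ∃[ β ] FundamentalVectors Y α β

  Full : (X F : Subset) → Set ℓ
  Full X F = F ⊆ X ×
    (∀ α β → α ∈ F → β ∈ F → F ∩ Span ｛ α ⨾ β ｝ ≐ X ∩ Span ｛ α ⨾ β ｝)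

  -- A repetition-free enumeration of X, finite or of order type ω; its
  -- existence makes X finite or countable.
  record Ordering (X : Subset) : Set ℓ where
    field
      length     : Length
      vector     : Index length → Carrierᴹ
      injective  : ∀ j k → vector j ≈ᴹ vector k → j ≡ k
      enumerates : ∀ v → v ∈ X ⇔ (∃[ j ] v ≈ᴹ vector j)

    -- {γ₁, …, γᵢ}: positions count from 0. For i = 0 this is empty, and for
    -- i beyond a finite length it is all of X.
    initial : ℕ → Subset
    initial i v = ∃[ j ] position j ℕ.< i × v ≈ᴹ vector j

  module _ {X : Subset} (γ : Ordering X) where
    open Ordering γ

    FundamentalsFirst : Set (suc ℓ)
    FundamentalsFirst =
      ∀ Y → TwoDimensionalLinearSubset X Y →
      ∀ α β → FundamentalVectors Y α β →
      ∀ j k → vector j ∈ ｛ α ⨾ β ｝ → vector k ∈ Y ∖ ｛ α ⨾ β ｝ →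
      position j ℕ.< position k

    LocallyClean : Set (suc ℓ)
    LocallyClean =
      ∀ i α β δ → α ∈ initial i → β ∈ initial i → δ ∈ initial i →
      ∃[ F ] Full X F × α ∈ F × β ∈ F × δ ∈ F × Clean (F ∩ initial i)

    Suitable : Set (suc ℓ)
    Suitable = FundamentalsFirst × LocallyClean

{-# OPTIONS --safe #-}

-- Build a set B along the ordering, adding γⱼ exactly when it lies in U or in
-- the cone of two vectors added earlier. By induction, B and its complement are
-- both closed in every initial segment. For the step, if γⱼ ∈ B then γⱼ is not
-- in the cone of two earlier vectors outside B: coclosedness of U rules this
-- out if γⱼ ∈ U, and weak separability inside a clean F ∩ Xⱼ rules it out if
-- γⱼ is in the cone of two vectors of B. A planar argument, using that the
-- fundamental vectors come first, then shows that adding γⱼ keeps both sides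
-- closed. The case γⱼ ∉ B is the same with B and its complement exchanged.
-- Hence B is biclosed in X, and it is the closure of U.

module Submission where

open import Defs
open import Algebra.Module.Bundles using (Module)
open import Axiom.ExcludedMiddle using (ExcludedMiddle)
open import Data.Empty using (⊥; ⊥-elim)
open import Data.Fin.Base as Fin using (Fin)
open import Data.Fin.Properties using (toℕ-injective)
open import Data.Nat.Base as ℕ using (ℕ; zero; s≤s; s≤s⁻¹)
import Data.Nat.Properties as ℕ
open import Data.Product.Base as Product using (∃-syntax; _×_; _,_; proj₁; proj₂)
open import Data.Sum.Base using (_⊎_; inj₁; inj₂; swap)
open import Data.Vec.Functional using ([]; _∷_)
open import Function.Base using (_∘_)
open import Function.Bundles using (module Equivalence)
open import Level using (Level; Lift; lift; lower; suc)
open import Relation.Binary.Definitions using (_Respects_)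
open import Relation.Binary.PropositionalEquality.Core as ≡ using (_≡_)
open import Relation.Binary.Structures using (IsTotalOrder)
open import Relation.Nullary using (¬_; yes; no; contradiction)
open import Relation.Nullary.Decidable using (map′)
open import Relation.Unary using (_∈_; _∉_; _⊆_; _∩_; _∖_; ∁)
import Algebra.Properties.Ring
import Algebra.Solver.Ring.NaturalCoefficients.Default
import Relation.Binary.Reasoning.Setoid

-- Order and sign rules in an ordered field.

module OrderedField {ℓ : Level} (em : ExcludedMiddle ℓ) (ℝ : RealField ℓ) where

  open RealField ℝ
  open Algebra.Properties.Ring ring
  open IsTotalOrder isTotalOrder
    using (total; antisym; ≤-respʳ-≈; ≤-respˡ-≈) renaming (trans to ≤-trans)
  open Relation.Binary.Reasoning.Setoid setoid

  negate-nonpos : ∀ {x} → x ≤ 0# → 0# ≤ - x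
  negate-nonpos {x} x≤0 =
    ≤-respˡ-≈ (-‿inverseʳ x) (≤-respʳ-≈ (+-identityˡ (- x)) (+-monoˡ-≤ (- x) x≤0))

  square-nonneg : ∀ x → 0# ≤ x * x
  square-nonneg x with total 0# x
  ... | inj₁ 0≤x = *-nonneg 0≤x 0≤x
  ... | inj₂ x≤0 = ≤-respʳ-≈ -x*-x≈x*x (*-nonneg 0≤-x 0≤-x)
    where
    0≤-x = negate-nonpos x≤0
    -x*-x≈x*x : - x * - x ≈ x * x
    -x*-x≈x*x = begin
      - x * - x    ≈⟨ -‿distribˡ-* x (- x) ⟨
      - (x * - x)  ≈⟨ -‿cong (-‿distribʳ-* x x) ⟨
      - - (x * x)  ≈⟨ -‿involutive (x * x) ⟩
      x * x        ∎

  0≤1 : 0# ≤ 1#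
  0≤1 = ≤-respʳ-≈ (*-identityˡ 1#) (square-nonneg 1#)

  x≤x+y : ∀ {x y} → 0# ≤ y → x ≤ x + y
  x≤x+y {x} {y} 0≤y =
    ≤-respˡ-≈ (+-identityˡ x) (≤-respʳ-≈ (+-comm y x) (+-monoˡ-≤ x 0≤y))

  +-nonneg : ∀ {x y} → 0# ≤ x → 0# ≤ y → 0# ≤ x + y
  +-nonneg 0≤x 0≤y = ≤-trans 0≤x (x≤x+y 0≤y)

  x+y≈0⇒x≈0 : ∀ {x y} → 0# ≤ x → 0# ≤ y → x + y ≈ 0# → x ≈ 0#
  x+y≈0⇒x≈0 0≤x 0≤y x+y≈0 = antisym (≤-respʳ-≈ x+y≈0 (x≤x+y 0≤y)) 0≤x

  -- Trades an inequality for an equation free of subtraction, a form that a commutative semiring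
  -- solver can work with.
  difference : ∀ {x y} → x ≤ y → ∃[ d ] 0# ≤ d × x + d ≈ y
  difference {x} {y} x≤y =
    y - x , ≤-respˡ-≈ (-‿inverseʳ x) (+-monoˡ-≤ (- x) x≤y) , (begin
      x + (y - x)    ≈⟨ +-comm x (y - x) ⟩
      y - x + x      ≈⟨ +-assoc y (- x) x ⟩
      y + (- x + x)  ≈⟨ +-congˡ (-‿inverseˡ x) ⟩
      y + 0#         ≈⟨ +-identityʳ y ⟩
      y              ∎)

  -- The inverse `y` equals `x * (y * y)`, a product of a nonnegative scalar and a square.
  nonneg-inverse : ∀ {x} → 0# ≤ x → ¬ x ≈ 0# → ∃[ y ] 0# ≤ y × y * x ≈ 1#
  nonneg-inverse {x} 0≤x x≉0 with inverse x x≉0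
  ... | y , xy≈1 = y , ≤-respʳ-≈ xyy≈y (*-nonneg 0≤x (square-nonneg y)) ,
                   trans (*-comm y x) xy≈1
    where
    xyy≈y : x * (y * y) ≈ y
    xyy≈y = begin
      x * (y * y)  ≈⟨ *-assoc x y y ⟨
      x * y * y    ≈⟨ *-congʳ xy≈1 ⟩
      1# * y       ≈⟨ *-identityˡ y ⟩
      y            ∎

  zero-product : ∀ {x y} → x * y ≈ 0# → x ≈ 0# ⊎ y ≈ 0#
  zero-product {x} {y} xy≈0 with em {x ≈ 0#}
  ... | yes x≈0 = inj₁ x≈0
  ... | no  x≉0 with inverse x x≉0
  ...   | x⁻¹ , xx⁻¹≈1 = inj₂ (begin
    y              ≈⟨ *-identityˡ y ⟨
    1# * y         ≈⟨ *-congʳ xx⁻¹≈1 ⟨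
    x * x⁻¹ * y    ≈⟨ *-congʳ (*-comm x x⁻¹) ⟩
    x⁻¹ * x * y    ≈⟨ *-assoc x⁻¹ x y ⟩
    x⁻¹ * (x * y)  ≈⟨ *-congˡ xy≈0 ⟩
    x⁻¹ * 0#       ≈⟨ zeroʳ x⁻¹ ⟩
    0#             ∎)

-- Planes and cones spanned by two vectors.

module Cones {ℓ : Level} (em : ExcludedMiddle ℓ) (ℝ : RealField ℓ)
             (V : Module (RealField.commutativeRing ℝ) ℓ ℓ) where

  open RealField ℝ renaming (Carrier to Scalar)
  open Algebra.Properties.Ring ring using (-‿distribˡ-*)
  open IsTotalOrder isTotalOrder using (total; ≤-respˡ-≈) renaming (refl to ≤-refl)
  open Module V
  open OrderedField em ℝ
  open Algebra.Solver.Ring.NaturalCoefficients.Default commutativeSemiring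
    using (solve; _:=_; _:+_; _:*_; con)
  module R = Relation.Binary.Reasoning.Setoid setoid
  open Relation.Binary.Reasoning.Setoid ≈ᴹ-setoid

  -- `Plane` and `Cone` are the two-coefficient forms of `Span` and `Span₊` of a pair. They replace
  -- families of arbitrary length by two coordinates, on which the planar arguments compute.
  Plane : Carrierᴹ → Carrierᴹ → Subset ℝ V
  Plane α β v = ∃[ s ] ∃[ t ] v ≈ᴹ s *ₗ α +ᴹ t *ₗ β

  Cone : Carrierᴹ → Carrierᴹ → Subset ℝ V
  Cone α β v = ∃[ s ] ∃[ t ] 0# ≤ s × 0# ≤ t × v ≈ᴹ s *ₗ α +ᴹ t *ₗ β

  combination : ∀ {α β v w a b c d} s t →
    v ≈ᴹ a *ₗ α +ᴹ b *ₗ β → w ≈ᴹ c *ₗ α +ᴹ d *ₗ β →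
    s *ₗ v +ᴹ t *ₗ w ≈ᴹ (s * a + t * c) *ₗ α +ᴹ (s * b + t * d) *ₗ β
  combination {α} {β} {v} {w} {a} {b} {c} {d} s t v≈ w≈ = begin
    s *ₗ v +ᴹ t *ₗ w
      ≈⟨ +ᴹ-cong (scale s a b v≈) (scale t c d w≈) ⟩
    ((s * a) *ₗ α +ᴹ (s * b) *ₗ β) +ᴹ ((t * c) *ₗ α +ᴹ (t * d) *ₗ β)
      ≈⟨ +ᴹ-assoc _ _ _ ⟩
    (s * a) *ₗ α +ᴹ ((s * b) *ₗ β +ᴹ ((t * c) *ₗ α +ᴹ (t * d) *ₗ β))
      ≈⟨ +ᴹ-congˡ (≈ᴹ-trans (≈ᴹ-sym (+ᴹ-assoc _ _ _))
           (≈ᴹ-trans (+ᴹ-congʳ (+ᴹ-comm _ _)) (+ᴹ-assoc _ _ _))) ⟩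
    (s * a) *ₗ α +ᴹ ((t * c) *ₗ α +ᴹ ((s * b) *ₗ β +ᴹ (t * d) *ₗ β))
      ≈⟨ +ᴹ-assoc _ _ _ ⟨
    ((s * a) *ₗ α +ᴹ (t * c) *ₗ α) +ᴹ ((s * b) *ₗ β +ᴹ (t * d) *ₗ β)
      ≈⟨ +ᴹ-cong (*ₗ-distribʳ α (s * a) (t * c)) (*ₗ-distribʳ β (s * b) (t * d)) ⟨
    (s * a + t * c) *ₗ α +ᴹ (s * b + t * d) *ₗ β ∎
    where
    scale : ∀ {x} k p q → x ≈ᴹ p *ₗ α +ᴹ q *ₗ β →
            k *ₗ x ≈ᴹ (k * p) *ₗ α +ᴹ (k * q) *ₗ β
    scale {x} k p q x≈ = begin
      k *ₗ x                          ≈⟨ *ₗ-cong refl x≈ ⟩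
      k *ₗ (p *ₗ α +ᴹ q *ₗ β)         ≈⟨ *ₗ-distribˡ k _ _ ⟩
      k *ₗ p *ₗ α +ᴹ k *ₗ q *ₗ β      ≈⟨ +ᴹ-cong (*ₗ-assoc k p α) (*ₗ-assoc k q β) ⟨
      (k * p) *ₗ α +ᴹ (k * q) *ₗ β    ∎

  *ₗ-as-combinationˡ : ∀ α β k → k *ₗ α ≈ᴹ k *ₗ α +ᴹ 0# *ₗ β
  *ₗ-as-combinationˡ α β k =
    ≈ᴹ-sym (≈ᴹ-trans (+ᴹ-congˡ (*ₗ-zeroˡ β)) (+ᴹ-identityʳ _))

  *ₗ-as-combinationʳ : ∀ α β k → k *ₗ β ≈ᴹ 0# *ₗ α +ᴹ k *ₗ β
  *ₗ-as-combinationʳ α β k =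
    ≈ᴹ-sym (≈ᴹ-trans (+ᴹ-congʳ (*ₗ-zeroˡ α)) (+ᴹ-identityˡ _))

  left : ∀ {α v} β → v ≈ᴹ α → v ≈ᴹ 1# *ₗ α +ᴹ 0# *ₗ β
  left {α} β v≈α =
    ≈ᴹ-trans v≈α (≈ᴹ-trans (≈ᴹ-sym (*ₗ-identityˡ α)) (*ₗ-as-combinationˡ α β 1#))

  right : ∀ {β v} α → v ≈ᴹ β → v ≈ᴹ 0# *ₗ α +ᴹ 1# *ₗ β
  right {β} α v≈β =
    ≈ᴹ-trans v≈β (≈ᴹ-trans (≈ᴹ-sym (*ₗ-identityˡ β)) (*ₗ-as-combinationʳ α β 1#))

  cone-left : ∀ {α v} β → v ≈ᴹ α → v ∈ Cone α β
  cone-left β v≈α = 1# , 0# , 0≤1 , ≤-refl , left β v≈α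

  cone-right : ∀ {β v} α → v ≈ᴹ β → v ∈ Cone α β
  cone-right α v≈β = 0# , 1# , ≤-refl , 0≤1 , right α v≈β

  cone-swap : ∀ {α β v} → v ∈ Cone α β → v ∈ Cone β α
  cone-swap (s , t , 0≤s , 0≤t , v≈) =
    t , s , 0≤t , 0≤s , ≈ᴹ-trans v≈ (+ᴹ-comm _ _)

  cone-resp : ∀ {α β v w} → v ≈ᴹ w → w ∈ Cone α β → v ∈ Cone α β
  cone-resp v≈w (s , t , 0≤s , 0≤t , w≈) = s , t , 0≤s , 0≤t , ≈ᴹ-trans v≈w w≈

  cone-+ : ∀ {α β v w s t} → 0# ≤ s → 0# ≤ t → v ∈ Cone α β → w ∈ Cone α β →
           s *ₗ v +ᴹ t *ₗ w ∈ Cone α β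
  cone-+ {s = s} {t} 0≤s 0≤t (a , b , 0≤a , 0≤b , v≈) (c , d , 0≤c , 0≤d , w≈) =
    s * a + t * c , s * b + t * d ,
    +-nonneg (*-nonneg 0≤s 0≤a) (*-nonneg 0≤t 0≤c) ,
    +-nonneg (*-nonneg 0≤s 0≤b) (*-nonneg 0≤t 0≤d) ,
    combination s t v≈ w≈

  cone-mono : ∀ {α β γ δ v} → α ∈ Cone γ δ → β ∈ Cone γ δ →
              v ∈ Cone α β → v ∈ Cone γ δ
  cone-mono α∈ β∈ (s , t , 0≤s , 0≤t , v≈) = cone-resp v≈ (cone-+ 0≤s 0≤t α∈ β∈)

  *ₗ-cancel : ∀ {k l v} → l * k ≈ 1# → l *ₗ k *ₗ v ≈ᴹ v
  *ₗ-cancel {k} {l} {v} lk≈1 = begin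
    l *ₗ k *ₗ v   ≈⟨ *ₗ-assoc l k v ⟨
    (l * k) *ₗ v  ≈⟨ *ₗ-cong lk≈1 ≈ᴹ-refl ⟩
    1# *ₗ v       ≈⟨ *ₗ-identityˡ v ⟩
    v             ∎

  cone-divide : ∀ {α β v k} → 0# ≤ k → ¬ k ≈ 0# → k *ₗ v ∈ Cone α β → v ∈ Cone α β
  cone-divide {v = v} {k} 0≤k k≉0 kv∈ with nonneg-inverse 0≤k k≉0
  ... | l , 0≤l , lk≈1 = cone-resp
    (≈ᴹ-trans (≈ᴹ-sym (*ₗ-cancel lk≈1)) (*ₗ-as-combinationˡ (k *ₗ v) (k *ₗ v) l))
    (cone-+ 0≤l ≤-refl kv∈ kv∈)

  *ₗ-zero⇒zero : ∀ {k v} → ¬ v ≈ᴹ 0ᴹ → k *ₗ v ≈ᴹ 0ᴹ → k ≈ 0#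
  *ₗ-zero⇒zero {k} {v} v≉0 kv≈0 with em {k ≈ 0#}
  ... | yes k≈0 = k≈0
  ... | no  k≉0 with inverse k k≉0
  ...   | l , kl≈1 = contradiction (begin
    v            ≈⟨ *ₗ-cancel (trans (*-comm l k) kl≈1) ⟨
    l *ₗ k *ₗ v  ≈⟨ *ₗ-cong refl kv≈0 ⟩
    l *ₗ 0ᴹ      ≈⟨ *ₗ-zeroʳ l ⟩
    0ᴹ           ∎) v≉0

  combination-cong : ∀ {α β a b c d} → a ≈ c → b ≈ d →
          a *ₗ α +ᴹ b *ₗ β ≈ᴹ c *ₗ α +ᴹ d *ₗ β
  combination-cong a≈c b≈d = +ᴹ-cong (*ₗ-cong a≈c ≈ᴹ-refl) (*ₗ-cong b≈d ≈ᴹ-refl)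

  -- The sign of the determinant of (y , g) in terms of (α , β) tells which of
  -- y and g lies closer to α. Each alternative is Cramer's rule, multiplied
  -- out and with the determinant d moved so that no subtraction occurs.
  planar : ∀ {α β g y z} → g ∈ Cone α β → y ∈ Cone α β → z ∈ Cone g y →
           z ∈ Cone α y ⊎ g ∈ Cone z β
  planar {α} {β} {g} {y} {z} (g₁ , g₂ , 0≤g₁ , 0≤g₂ , g≈) (y₁ , y₂ , 0≤y₁ , 0≤y₂ , y≈)
         (s , t , 0≤s , 0≤t , z≈) = by-orientation
    where
    z₁ z₂ : Scalar
    z₁ = s * g₁ + t * y₁
    z₂ = s * g₂ + t * y₂

    0≤z₁ : 0# ≤ z₁
    0≤z₁ = +-nonneg (*-nonneg 0≤s 0≤g₁) (*-nonneg 0≤t 0≤y₁)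

    0≤z₂ : 0# ≤ z₂
    0≤z₂ = +-nonneg (*-nonneg 0≤s 0≤g₂) (*-nonneg 0≤t 0≤y₂)

    z≈₁₂ : z ≈ᴹ z₁ *ₗ α +ᴹ z₂ *ₗ β
    z≈₁₂ = ≈ᴹ-trans z≈ (combination s t g≈ y≈)

    g-first : y₂ * g₁ ≤ y₁ * g₂ → z ∈ Cone α y ⊎ g ∈ Cone z β
    g-first le with difference le | em {z₁ ≈ 0#}
    ... | d , 0≤d , eq | no z₁≉0 =
      inj₂ (cone-divide 0≤z₁ z₁≉0 (g₁ , t * d , 0≤g₁ , *-nonneg 0≤t 0≤d , (begin
        z₁ *ₗ g                               ≈⟨ *ₗ-as-combinationˡ g g z₁ ⟩
        z₁ *ₗ g +ᴹ 0# *ₗ g                    ≈⟨ combination z₁ 0# g≈ g≈ ⟩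
        (z₁ * g₁ + 0# * g₁) *ₗ α +ᴹ (z₁ * g₂ + 0# * g₂) *ₗ β
          ≈⟨ combination-cong coeff₁ coeff₂ ⟩
        (g₁ * z₁ + t * d * 0#) *ₗ α +ᴹ (g₁ * z₂ + t * d * 1#) *ₗ β
          ≈⟨ combination g₁ (t * d) z≈₁₂ (right α ≈ᴹ-refl) ⟨
        g₁ *ₗ z +ᴹ (t * d) *ₗ β               ∎)))
      where
      coeff₁ : z₁ * g₁ + 0# * g₁ ≈ g₁ * z₁ + t * d * 0#
      coeff₁ = solve 4 (λ z g t d →
        z :* g :+ con 0 :* g := g :* z :+ t :* d :* con 0) refl z₁ g₁ t d

      coeff₂ : z₁ * g₂ + 0# * g₂ ≈ g₁ * z₂ + t * d * 1#
      coeff₂ = R.begin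
        z₁ * g₂ + 0# * g₂
          R.≈⟨ solve 5 (λ s t g₁ g₂ y₁ →
                 (s :* g₁ :+ t :* y₁) :* g₂ :+ con 0 :* g₂ :=
                 s :* g₁ :* g₂ :+ t :* (y₁ :* g₂)) refl s t g₁ g₂ y₁ ⟩
        s * g₁ * g₂ + t * (y₁ * g₂)
          R.≈⟨ +-congˡ (*-congˡ eq) ⟨
        s * g₁ * g₂ + t * (y₂ * g₁ + d)
          R.≈⟨ solve 6 (λ s t g₁ g₂ y₂ d →
                 s :* g₁ :* g₂ :+ t :* (y₂ :* g₁ :+ d) :=
                 g₁ :* (s :* g₂ :+ t :* y₂) :+ t :* d :* (con 1))
                 refl s t g₁ g₂ y₂ d ⟩
        g₁ * z₂ + t * d * 1# R.∎
    -- Here division by `z₁` is impossible. Both summands of `z₁` are nonnegative, so `s * g₁`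
    -- vanishes: either `s` is zero and `z` is a multiple of `y`, or `g₁` is zero and `g` is a
    -- multiple of `β`.
    ... | _ | yes z₁≈0
      with zero-product (x+y≈0⇒x≈0 (*-nonneg 0≤s 0≤g₁) (*-nonneg 0≤t 0≤y₁) z₁≈0)
    ...   | inj₁ s≈0 = inj₁ (0# , t , ≤-refl , 0≤t ,
        ≈ᴹ-trans z≈ (≈ᴹ-trans (+ᴹ-congʳ (*ₗ-cong s≈0 ≈ᴹ-refl))
          (≈ᴹ-trans (+ᴹ-congʳ (*ₗ-zeroˡ g)) (≈ᴹ-trans (+ᴹ-identityˡ _)
            (*ₗ-as-combinationʳ α y t)))))
    ...   | inj₂ g₁≈0 = inj₂ (0# , g₂ , ≤-refl , 0≤g₂ ,
        ≈ᴹ-trans g≈ (≈ᴹ-trans (+ᴹ-congʳ (*ₗ-cong g₁≈0 ≈ᴹ-refl))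
          (≈ᴹ-trans (+ᴹ-congʳ (*ₗ-zeroˡ α)) (≈ᴹ-trans (+ᴹ-identityˡ _)
            (*ₗ-as-combinationʳ z β g₂)))))

    y-first : ¬ y₂ ≈ 0# → y₁ * g₂ ≤ y₂ * g₁ → z ∈ Cone α y ⊎ g ∈ Cone z β
    y-first y₂≉0 le with difference le
    ... | d , 0≤d , eq =
      inj₁ (cone-divide 0≤y₂ y₂≉0 (s * d , z₂ , *-nonneg 0≤s 0≤d , 0≤z₂ , (begin
        y₂ *ₗ z                               ≈⟨ *ₗ-as-combinationˡ z z y₂ ⟩
        y₂ *ₗ z +ᴹ 0# *ₗ z                    ≈⟨ combination y₂ 0# z≈₁₂ z≈₁₂ ⟩
        (y₂ * z₁ + 0# * z₁) *ₗ α +ᴹ (y₂ * z₂ + 0# * z₂) *ₗ β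
          ≈⟨ combination-cong coeff₁ coeff₂ ⟩
        (s * d * 1# + z₂ * y₁) *ₗ α +ᴹ (s * d * 0# + z₂ * y₂) *ₗ β
          ≈⟨ combination (s * d) z₂ (left β ≈ᴹ-refl) y≈ ⟨
        (s * d) *ₗ α +ᴹ z₂ *ₗ y               ∎)))
      where
      coeff₁ : y₂ * z₁ + 0# * z₁ ≈ s * d * 1# + z₂ * y₁
      coeff₁ = R.begin
        y₂ * z₁ + 0# * z₁
          R.≈⟨ solve 5 (λ s t g₁ y₁ y₂ →
                 y₂ :* (s :* g₁ :+ t :* y₁) :+ con 0 :* (s :* g₁ :+ t :* y₁) :=
                 s :* (y₂ :* g₁) :+ t :* y₁ :* y₂) refl s t g₁ y₁ y₂ ⟩
        s * (y₂ * g₁) + t * y₁ * y₂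
          R.≈⟨ +-congʳ (*-congˡ eq) ⟨
        s * (y₁ * g₂ + d) + t * y₁ * y₂
          R.≈⟨ solve 6 (λ s t g₂ y₁ y₂ d →
                 s :* (y₁ :* g₂ :+ d) :+ t :* y₁ :* y₂ :=
                 s :* d :* (con 1) :+ (s :* g₂ :+ t :* y₂) :* y₁)
                 refl s t g₂ y₁ y₂ d ⟩
        s * d * 1# + z₂ * y₁ R.∎

      coeff₂ : y₂ * z₂ + 0# * z₂ ≈ s * d * 0# + z₂ * y₂
      coeff₂ = solve 4 (λ z y s d →
        y :* z :+ con 0 :* z := s :* d :* con 0 :+ z :* y) refl z₂ y₂ s d

    by-orientation : z ∈ Cone α y ⊎ g ∈ Cone z β
    by-orientation with em {y₂ ≈ 0#} | total (y₂ * g₁) (y₁ * g₂)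
    ... | _        | inj₁ le = g-first le
    ... | no  y₂≉0 | inj₂ le = y-first y₂≉0 le
    -- `y-first` divides by `y₂`. When `y₂` is zero, `y₂ * g₁` vanishes and is at most `y₁ * g₂`, so
    -- `g-first` applies instead.
    ... | yes y₂≈0 | inj₂ le = g-first
      (≤-respˡ-≈
        (sym (trans (*-congʳ y₂≈0) (zeroˡ g₁))) (*-nonneg 0≤y₁ 0≤g₂))

  -- The degenerate counterpart of `planar`, for `g` and `y` on one line. Here `z` is `e *ₗ y` with
  -- `e = s * k + t`. If `e` is nonnegative, `z` is on the ray of `y`. Otherwise `k` is nonpositive
  -- too, so `g` and `z` both point away from `y` and `g` is on the ray of `z`.
  collinear : ∀ {g y z k} → ¬ z ≈ᴹ 0ᴹ → g ≈ᴹ k *ₗ y → z ∈ Cone g y →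
              z ∈ Cone y y ⊎ g ∈ Cone z z
  collinear {g} {y} {z} {k} z≉0 g≈ (s , t , 0≤s , 0≤t , z≈) = by-sign
    where
    e : Scalar
    e = s * k + t

    z≈ey : z ≈ᴹ e *ₗ y
    z≈ey = begin
      z                      ≈⟨ z≈ ⟩
      s *ₗ g +ᴹ t *ₗ y       ≈⟨ +ᴹ-congʳ (*ₗ-cong refl g≈) ⟩
      s *ₗ k *ₗ y +ᴹ t *ₗ y  ≈⟨ +ᴹ-congʳ (*ₗ-assoc s k y) ⟨
      (s * k) *ₗ y +ᴹ t *ₗ y ≈⟨ *ₗ-distribʳ y (s * k) t ⟨
      e *ₗ y                 ∎

    same-side : 0# ≤ e → z ∈ Cone y y ⊎ g ∈ Cone z z
    same-side 0≤e =
      inj₁ (e , 0# , 0≤e , ≤-refl , ≈ᴹ-trans z≈ey (*ₗ-as-combinationˡ y y e))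

    -e≉0 : ¬ - e ≈ 0#
    -e≉0 -e≈0 = z≉0 (begin
      z        ≈⟨ z≈ey ⟩
      e *ₗ y   ≈⟨ *ₗ-cong e≈0 ≈ᴹ-refl ⟩
      0# *ₗ y  ≈⟨ *ₗ-zeroˡ y ⟩
      0ᴹ       ∎)
      where
      e≈0 : e ≈ 0#
      e≈0 = R.begin
        e        R.≈⟨ +-identityʳ e ⟨
        e + 0#   R.≈⟨ +-congˡ -e≈0 ⟨
        e + - e  R.≈⟨ -‿inverseʳ e ⟩
        0#       R.∎

    by-sign : z ∈ Cone y y ⊎ g ∈ Cone z z
    by-sign with total 0# k | total 0# e
    ... | inj₁ 0≤k | _        = same-side (+-nonneg (*-nonneg 0≤s 0≤k) 0≤t)
    ... | inj₂ k≤0 | inj₁ 0≤e = same-side 0≤e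
    ... | inj₂ k≤0 | inj₂ e≤0 = inj₂ (cone-divide (negate-nonpos e≤0) -e≉0
      (- k , 0# , negate-nonpos k≤0 , ≤-refl , (begin
        - e *ₗ g           ≈⟨ *ₗ-cong refl g≈ ⟩
        - e *ₗ k *ₗ y      ≈⟨ *ₗ-assoc (- e) k y ⟨
        (- e * k) *ₗ y     ≈⟨ *ₗ-cong -ek≈-ke ≈ᴹ-refl ⟩
        (- k * e) *ₗ y     ≈⟨ *ₗ-assoc (- k) e y ⟩
        - k *ₗ e *ₗ y      ≈⟨ *ₗ-cong refl z≈ey ⟨
        - k *ₗ z           ≈⟨ *ₗ-as-combinationˡ z z (- k) ⟩
        - k *ₗ z +ᴹ 0# *ₗ z ∎)))
      where
      -ek≈-ke : - e * k ≈ - k * e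
      -ek≈-ke = R.begin
        - e * k    R.≈⟨ -‿distribˡ-* e k ⟨
        - (e * k)  R.≈⟨ -‿cong (*-comm e k) ⟩
        - (k * e)  R.≈⟨ -‿distribˡ-* k e ⟩
        - k * e    R.∎

  isolate : ∀ {s t v w x} → ¬ s ≈ 0# → x ≈ᴹ s *ₗ v +ᴹ t *ₗ w → v ∈ Plane x w
  isolate {s} {t} {v} {w} {x} s≉0 x≈ with inverse s s≉0
  ... | l , sl≈1 = l , - (l * t) , (begin
    v                          ≈⟨ left w ≈ᴹ-refl ⟩
    1# *ₗ v +ᴹ 0# *ₗ w         ≈⟨ combination-cong coeff₁ coeff₂ ⟩
    (l * s + - (l * t) * 0#) *ₗ v +ᴹ (l * t + - (l * t) * 1#) *ₗ w
                               ≈⟨ combination l (- (l * t)) x≈ (right v ≈ᴹ-refl) ⟨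
    l *ₗ x +ᴹ - (l * t) *ₗ w   ∎)
    where
    coeff₁ : 1# ≈ l * s + - (l * t) * 0#
    coeff₁ = R.begin
      1#                      R.≈⟨ sl≈1 ⟨
      s * l                   R.≈⟨ *-comm s l ⟩
      l * s                   R.≈⟨ +-identityʳ (l * s) ⟨
      l * s + 0#              R.≈⟨ +-congˡ (zeroʳ (- (l * t))) ⟨
      l * s + - (l * t) * 0#  R.∎

    coeff₂ : 0# ≈ l * t + - (l * t) * 1#
    coeff₂ = R.begin
      0#                      R.≈⟨ -‿inverseʳ (l * t) ⟨
      l * t + - (l * t)       R.≈⟨ +-congˡ (*-identityʳ (- (l * t))) ⟨
      l * t + - (l * t) * 1#  R.∎

  -- Since `v` is nonzero, its coefficient `s + t` along `w` is nonzero and can be divided out.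
  cone-invert : ∀ {v w} → ¬ v ≈ᴹ 0ᴹ → v ∈ Cone w w → w ∈ Cone v v
  cone-invert {v} {w} v≉0 (s , t , 0≤s , 0≤t , v≈) =
    cone-divide (+-nonneg 0≤s 0≤t) s+t≉0 (cone-left v (≈ᴹ-sym v≈[s+t]w))
    where
    v≈[s+t]w : v ≈ᴹ (s + t) *ₗ w
    v≈[s+t]w = ≈ᴹ-trans v≈ (≈ᴹ-sym (*ₗ-distribʳ w s t))

    s+t≉0 : ¬ s + t ≈ 0#
    s+t≉0 s+t≈0 =
      v≉0 (≈ᴹ-trans v≈[s+t]w (≈ᴹ-trans (*ₗ-cong s+t≈0 ≈ᴹ-refl) (*ₗ-zeroˡ w)))

  plane-isSubspace : ∀ α β → IsSubspace ℝ V (Plane α β)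
  plane-isSubspace α β = record
    { resp      = λ v≈w (s , t , v≈) → s , t , ≈ᴹ-trans (≈ᴹ-sym v≈w) v≈
    ; 0-closed  = 0# , 0# , ≈ᴹ-trans (≈ᴹ-sym (*ₗ-zeroˡ α)) (*ₗ-as-combinationˡ α β 0#)
    ; +-closed  = λ (_ , _ , v≈) (_ , _ , w≈) → _ , _ ,
        ≈ᴹ-trans (+ᴹ-cong (≈ᴹ-sym (*ₗ-identityˡ _)) (≈ᴹ-sym (*ₗ-identityˡ _)))
          (combination 1# 1# v≈ w≈)
    ; *ₗ-closed = λ k (_ , _ , v≈) → _ , _ ,
        ≈ᴹ-trans (*ₗ-as-combinationˡ _ _ k) (combination k 0# v≈ v≈)
    }

  span-least : ∀ {A L} → IsSubspace ℝ V L → A ⊆ L → Span ℝ V A ⊆ L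
  span-least {A} {L} L-subspace A⊆L (n , c , a , a∈A , v≈) =
    resp (≈ᴹ-sym v≈) (sum-closed n c a a∈A)
    where
    open IsSubspace L-subspace
    sum-closed : ∀ n c a → (∀ (i : Fin n) → a i ∈ A) → ∑ ℝ V c a ∈ L
    sum-closed zero    c a a∈A = 0-closed
    sum-closed (ℕ.suc n) c a a∈A = +-closed (*ₗ-closed _ (A⊆L (a∈A Fin.zero)))
      (sum-closed n (c ∘ Fin.suc) (a ∘ Fin.suc) (a∈A ∘ Fin.suc))

  span₊⇒cone : ∀ {α β} → Span₊ ℝ V (｛_⨾_｝ ℝ V α β) ⊆ Cone α β
  span₊⇒cone {α} {β} (n , c , a , a∈ , 0≤c , v≈) =
    cone-resp v≈ (sum-closed n c a a∈ 0≤c)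
    where
    generator∈ : ∀ {v} → v ∈ ｛_⨾_｝ ℝ V α β → v ∈ Cone α β
    generator∈ (inj₁ v≈α) = cone-left β v≈α
    generator∈ (inj₂ v≈β) = cone-right α v≈β

    sum-closed : ∀ n c a → (∀ (i : Fin n) → a i ∈ ｛_⨾_｝ ℝ V α β) →
                 (∀ i → 0# ≤ c i) → ∑ ℝ V c a ∈ Cone α β
    sum-closed zero c a a∈ 0≤c = 0# , 0# , ≤-refl , ≤-refl ,
      ≈ᴹ-trans (≈ᴹ-sym (*ₗ-zeroˡ α)) (*ₗ-as-combinationˡ α β 0#)
    sum-closed (ℕ.suc n) c a a∈ 0≤c = cone-resp
      (+ᴹ-congˡ (≈ᴹ-sym (*ₗ-identityˡ _)))
      (cone-+ (0≤c Fin.zero) 0≤1 (generator∈ (a∈ Fin.zero))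
        (sum-closed n (c ∘ Fin.suc) (a ∘ Fin.suc) (a∈ ∘ Fin.suc) (0≤c ∘ Fin.suc)))

  ∑-pair : ∀ s t α β →
           s *ₗ α +ᴹ t *ₗ β ≈ᴹ ∑ ℝ V (s ∷ t ∷ []) (α ∷ β ∷ [])
  ∑-pair s t α β = +ᴹ-congˡ (≈ᴹ-sym (+ᴹ-identityʳ _))

  plane⇒span : ∀ {A : Subset ℝ V} {α β} → α ∈ A → β ∈ A → Plane α β ⊆ Span ℝ V A
  plane⇒span {A} {α} {β} α∈A β∈A (s , t , v≈) =
    2 , s ∷ t ∷ [] , α ∷ β ∷ [] ,
    (λ { Fin.zero → α∈A ; (Fin.suc Fin.zero) → β∈A }) ,
    ≈ᴹ-trans v≈ (∑-pair s t α β)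

  cone⇒span₊ : ∀ {A : Subset ℝ V} {α β} → α ∈ A → β ∈ A → Cone α β ⊆ Span₊ ℝ V A
  cone⇒span₊ {A} {α} {β} α∈A β∈A (s , t , 0≤s , 0≤t , v≈) =
    2 , s ∷ t ∷ [] , α ∷ β ∷ [] ,
    (λ { Fin.zero → α∈A ; (Fin.suc Fin.zero) → β∈A }) ,
    (λ { Fin.zero → 0≤s ; (Fin.suc Fin.zero) → 0≤t }) ,
    ≈ᴹ-trans v≈ (∑-pair s t α β)

  cone⇒span₊-pair : ∀ {α β} → Cone α β ⊆ Span₊ ℝ V (｛_⨾_｝ ℝ V α β)
  cone⇒span₊-pair {α} {β} =
    cone⇒span₊ {｛_⨾_｝ ℝ V α β} (inj₁ ≈ᴹ-refl) (inj₂ ≈ᴹ-refl)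

  cone⇒plane : ∀ {α β} → Cone α β ⊆ Plane α β
  cone⇒plane (s , t , _ , _ , v≈) = s , t , v≈

  independent : ∀ {α β} → ¬ β ≈ᴹ 0ᴹ → ¬ (∃[ k ] α ≈ᴹ k *ₗ β) →
                LinearlyIndependent ℝ V (α ∷ β ∷ [])
  independent {α} {β} β≉0 α∦β c ∑≈0 = λ { Fin.zero → c₀≈0 ; (Fin.suc Fin.zero) → c₁≈0 }
    where
    c₀ c₁ : Scalar
    c₀ = c Fin.zero
    c₁ = c (Fin.suc Fin.zero)

    relation : c₀ *ₗ α +ᴹ c₁ *ₗ β ≈ᴹ 0ᴹ
    relation = ≈ᴹ-trans (∑-pair c₀ c₁ α β) ∑≈0

    c₀≈0 : c₀ ≈ 0#
    c₀≈0 with em {c₀ ≈ 0#}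
    ... | yes p = p
    ... | no  c₀≉0 with isolate c₀≉0 (≈ᴹ-sym relation)
    ...   | l , m , α≈ = contradiction
      (m , ≈ᴹ-trans α≈ (≈ᴹ-trans (+ᴹ-congʳ (*ₗ-zeroʳ l)) (+ᴹ-identityˡ _))) α∦β

    c₁≈0 : c₁ ≈ 0#
    c₁≈0 = *ₗ-zero⇒zero β≉0 (begin
      c₁ *ₗ β               ≈⟨ *ₗ-as-combinationʳ α β c₁ ⟩
      0# *ₗ α +ᴹ c₁ *ₗ β    ≈⟨ combination-cong c₀≈0 refl ⟨
      c₀ *ₗ α +ᴹ c₁ *ₗ β    ≈⟨ relation ⟩
      0ᴹ                    ∎)

  -- Supplies the linear subsets to which the existence of fundamental vectors and their place in
  -- the ordering are applied.
  plane-twoDimensional : ∀ {X : Subset ℝ V} {α β} → α ∈ X → β ∈ X → ¬ β ≈ᴹ 0ᴹ →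
    ¬ (∃[ k ] α ≈ᴹ k *ₗ β) → TwoDimensionalLinearSubset ℝ V X (X ∩ Plane α β)
  plane-twoDimensional {X} {α} {β} α∈X β∈X β≉0 α∦β =
    (Plane α β , plane-isSubspace α β , (λ p → p) , (λ p → p)) ,
    α ∷ β ∷ [] , basis∈ , independent β≉0 α∦β , spans
    where
    α∈ : α ∈ X ∩ Plane α β
    α∈ = α∈X , 1# , 0# , left β ≈ᴹ-refl

    β∈ : β ∈ X ∩ Plane α β
    β∈ = β∈X , 0# , 1# , right α ≈ᴹ-refl

    basis∈ : ∀ i → (α ∷ β ∷ []) i ∈ Span ℝ V (X ∩ Plane α β)
    basis∈ Fin.zero           = plane⇒span {A = X ∩ Plane α β} α∈ β∈ (proj₂ α∈)
    basis∈ (Fin.suc Fin.zero) = plane⇒span {A = X ∩ Plane α β} α∈ β∈ (proj₂ β∈)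

    spans : ∀ v → v ∈ Span ℝ V (X ∩ Plane α β) → ∃[ c ] v ≈ᴹ ∑ ℝ V c (α ∷ β ∷ [])
    spans v v∈ with span-least {X ∩ Plane α β} (plane-isSubspace α β) proj₂ v∈
    ... | s , t , v≈ = s ∷ t ∷ [] , ≈ᴹ-trans v≈ (∑-pair s t α β)

-- Separating the vectors of `X` along the ordering.

module Separations {ℓ : Level} (em : ExcludedMiddle ℓ) (ℝ : RealField ℓ)
  (V : Module (RealField.commutativeRing ℝ) ℓ ℓ)
  (X : Subset ℝ V) (0∉X : Module.0ᴹ V ∉ X)
  (fundamentals : ∀ Y → TwoDimensionalLinearSubset ℝ V X Y → HasFundamentalVectors ℝ V Y)
  (γ : Ordering ℝ V X) (suitable : Suitable ℝ V γ) where

  open RealField ℝ using (0#; _≈_)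
  open Module V
  open Cones em ℝ V
  open Ordering γ

  -- Unlike in `Closed`, `S` need not lie inside `Z`, so one fixed set can be tested against every
  -- initial segment.
  ClosedIn : (Z S : Subset ℝ V) → Set ℓ
  ClosedIn Z S = ∀ {x y z} → x ∈ Z → y ∈ Z → z ∈ Z → x ∈ S → y ∈ S → z ∈ Cone x y → z ∈ S

  -- A set and its complement in symmetric form, so that the insertion step serves for either side.
  -- It partitions all of `V` and thus does not depend on an initial segment.
  record Partition (S T : Subset ℝ V) : Set ℓ where
    field
      cover    : ∀ v → v ∈ S ⊎ v ∈ T
      disjoint : ∀ {v} → v ∈ S → v ∉ T
      respˡ    : S Respects _≈ᴹ_
      respʳ    : T Respects _≈ᴹ_

  flip-partition : ∀ {S T} → Partition S T → Partition T S
  flip-partition P = record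
    { cover = swap ∘ cover ; disjoint = λ v∈T v∈S → disjoint v∈S v∈T
    ; respˡ = respʳ ; respʳ = respˡ }
    where open Partition P

  vector∈X : ∀ {v} j → v ≈ᴹ vector j → v ∈ X
  vector∈X j v≈ = Equivalence.from (enumerates _) (j , v≈)

  index : ∀ {v} → v ∈ X → ∃[ j ] v ≈ᴹ vector j
  index = Equivalence.to (enumerates _)

  nonzero : ∀ {v} → v ∈ X → ¬ v ≈ᴹ 0ᴹ
  nonzero v∈X v≈0 with index v∈X
  ... | j , v≈ = 0∉X (vector∈X j (≈ᴹ-trans (≈ᴹ-sym v≈0) v≈))

  initial⊆X : ∀ {i} → initial i ⊆ X
  initial⊆X (j , _ , v≈) = vector∈X j v≈

  position-injective : ∀ {N} {j k : Index N} → position j ≡ position k → j ≡ k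
  position-injective {finite n} = toℕ-injective
  position-injective {infinite} = λ p → p

  initial-mono : ∀ {i j} → i ℕ.≤ j → initial i ⊆ initial j
  initial-mono i≤j (k , k<i , v≈) = k , ℕ.<-≤-trans k<i i≤j , v≈

  initial-suc : ∀ j {v} → v ∈ initial (ℕ.suc (position j)) →
                v ∈ initial (position j) ⊎ v ≈ᴹ vector j
  initial-suc j (k , k<1+j , v≈) with ℕ.m≤n⇒m<n∨m≡n (s≤s⁻¹ k<1+j)
  ... | inj₁ k<j = inj₁ (k , k<j , v≈)
  ... | inj₂ k≡j with position-injective {length} {k} {j} k≡j
  ...   | ≡.refl = inj₂ v≈

  vector∉initial : ∀ j {v} → v ≈ᴹ vector j → v ∉ initial (position j)
  vector∉initial j v≈ (k , k<j , v≈′)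
    with injective k j (≈ᴹ-trans (≈ᴹ-sym v≈′) v≈)
  ... | ≡.refl = ℕ.<-irrefl ≡.refl k<j

  -- Adding one vector to a separated initial segment.

  module Insertion {S T : Subset ℝ V} (P : Partition S T) (j : Index length)
    (S-closed : ClosedIn (initial (position j)) S)
    (T-closed : ClosedIn (initial (position j)) T)
    (g∈S : vector j ∈ S)
    (g∉cone : ∀ {c d} → c ∈ initial (position j) → d ∈ initial (position j) →
              c ∈ T → d ∈ T → vector j ∉ Cone c d) where

    open Partition P

    private
      Z : Subset ℝ V
      Z = initial (position j)

      g : Carrierᴹ
      g = vector j

      g∈X : g ∈ X
      g∈X = vector∈X j ≈ᴹ-refl

    -- The essential new way in which `S` could stop being closed: `g` together with an earlier `y`
    -- in `S` captures an earlier `z` in `T`. The declarations below refute this configuration.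
    module _ {y z : Carrierᴹ} (y∈Z : y ∈ Z) (z∈Z : z ∈ Z) (y∈S : y ∈ S) (z∈T : z ∈ T)
             (z∈cone : z ∈ Cone g y) where

      private
        y∈X : y ∈ X
        y∈X = initial⊆X y∈Z

        z∈X : z ∈ X
        z∈X = initial⊆X z∈Z

        Y : Subset ℝ V
        Y = X ∩ Plane g y

        g∈Y : g ∈ Y
        g∈Y = g∈X , cone⇒plane (cone-left y ≈ᴹ-refl)

        y∈Y : y ∈ Y
        y∈Y = y∈X , cone⇒plane (cone-right g ≈ᴹ-refl)

        z∈Y : z ∈ Y
        z∈Y = z∈X , cone⇒plane z∈cone

        z≉g : ¬ z ≈ᴹ g
        z≉g z≈g = vector∉initial j z≈g z∈Z

        z≉y : ¬ z ≈ᴹ y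
        z≉y z≈y = disjoint y∈S (respʳ z≈y z∈T)

      module _ (g∦y : ¬ (∃[ k ] g ≈ᴹ k *ₗ y)) where

        private
          Y-2-dim : TwoDimensionalLinearSubset ℝ V X Y
          Y-2-dim = plane-twoDimensional {X} g∈X y∈X (nonzero y∈X) g∦y

        swap-fundamental : ∀ {α β} → FundamentalVectors ℝ V Y α β →
                           FundamentalVectors ℝ V Y β α
        swap-fundamental (α∈Y , β∈Y , Y⊆ , α∉ , β∉) = β∈Y , α∈Y ,
          (λ v∈Y → cone⇒span₊-pair
                     (cone-swap (span₊⇒cone (Y⊆ v∈Y)))) ,
          β∉ , α∉

        -- z precedes g, so it cannot be non-fundamental when g is fundamental.
        g-not-fundamental : ∀ {α β} → FundamentalVectors ℝ V Y α β → ¬ g ≈ᴹ α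
        g-not-fundamental {α} {β} fund@(α∈Y , β∈Y , Y⊆ , α∉ , β∉) g≈α
          with em {z ≈ᴹ β} | index z∈X
        -- If `z` is the other fundamental vector, then `g` and `y`, both in `Y` and different from
        -- `β`, have `β` in their cone, against the extremality of `β`.
        ... | yes z≈β | _ = β∉ (cone⇒span₊ {Y ∖ ｛_｝ ℝ V β}
            (g∈Y , λ g≈β → z≉g (≈ᴹ-trans z≈β (≈ᴹ-sym g≈β)))
            (y∈Y , λ y≈β → z≉y (≈ᴹ-trans z≈β (≈ᴹ-sym y≈β)))
            (cone-resp (≈ᴹ-sym z≈β) z∈cone))
        ... | no z≉β | k , z≈k = z∉Z z∈Z
          where
          k∈Y∖αβ : vector k ∈ Y ∖ ｛_⨾_｝ ℝ V α β
          k∈Y∖αβ =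
            (vector∈X k ≈ᴹ-refl , IsSubspace.resp (plane-isSubspace g y) z≈k (proj₂ z∈Y)) ,
            λ { (inj₁ k≈α) → z≉g (≈ᴹ-trans (≈ᴹ-trans z≈k k≈α) (≈ᴹ-sym g≈α))
              ; (inj₂ k≈β) → z≉β (≈ᴹ-trans z≈k k≈β) }

          z∉Z : z ∉ Z
          z∉Z z∈Z = vector∉initial k z≈k (initial-mono (ℕ.<⇒≤
            (proj₁ suitable Y Y-2-dim α β fund j k (inj₁ g≈α) k∈Y∖αβ)) z∈Z)

        -- With `g` non-fundamental, the ordering puts the fundamental vectors of `Y` before `g`.
        fundamental∈Z : ∀ {α β} → FundamentalVectors ℝ V Y α β →
                        ¬ g ≈ᴹ α → ¬ g ≈ᴹ β → α ∈ Z
        fundamental∈Z {α} {β} fund g≉α g≉β with index (proj₁ (proj₁ fund))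
        ... | k , α≈k = k ,
          proj₁ suitable Y Y-2-dim α β fund k j (inj₁ (≈ᴹ-sym α≈k))
            (g∈Y , λ { (inj₁ g≈α) → g≉α g≈α ; (inj₂ g≈β) → g≉β g≈β }) ,
          α≈k

        -- By `planar`, either `z` is in the cone of `α` and `y`, both in `S`, or `g` is in the cone
        -- of `z` and `β`, both in `T`. Closedness of `S` excludes the first, `g∉cone` the second.
        separated-fundamentals : ∀ {α β} → FundamentalVectors ℝ V Y α β →
          α ∈ Z → β ∈ Z → α ∈ S → β ∈ T → ⊥
        separated-fundamentals (_ , _ , Y⊆ , _) α∈Z β∈Z α∈S β∈T
          with planar (span₊⇒cone (Y⊆ g∈Y)) (span₊⇒cone (Y⊆ y∈Y)) z∈cone
        ... | inj₁ z∈αy = disjoint (S-closed α∈Z y∈Z z∈Z α∈S y∈S z∈αy) z∈T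
        ... | inj₂ g∈zβ = g∉cone z∈Z β∈Z z∈T β∈T g∈zβ

        -- Both fundamental vectors come before `g`. If both are in `S`, so is `z`; if both are in
        -- `T`, so is `y`; otherwise they are separated.
        no-fundamentals : ∀ {α β} → FundamentalVectors ℝ V Y α β → ⊥
        no-fundamentals {α} {β} fund@(_ , _ , Y⊆ , _) = by-side (cover α) (cover β)
          where
          fund′ = swap-fundamental fund
          g≉α = g-not-fundamental fund
          g≉β = g-not-fundamental fund′
          α∈Z = fundamental∈Z fund g≉α g≉β
          β∈Z = fundamental∈Z fund′ g≉β g≉α

          by-side : α ∈ S ⊎ α ∈ T → β ∈ S ⊎ β ∈ T → ⊥
          by-side (inj₁ α∈S) (inj₁ β∈S) = disjoint
            (S-closed α∈Z β∈Z z∈Z α∈S β∈S (span₊⇒cone (Y⊆ z∈Y))) z∈T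
          by-side (inj₂ α∈T) (inj₂ β∈T) = disjoint y∈S
            (T-closed α∈Z β∈Z y∈Z α∈T β∈T (span₊⇒cone (Y⊆ y∈Y)))
          by-side (inj₁ α∈S) (inj₂ β∈T) = separated-fundamentals fund α∈Z β∈Z α∈S β∈T
          by-side (inj₂ α∈T) (inj₁ β∈S) = separated-fundamentals fund′ β∈Z α∈Z β∈S α∈T

      no-escape : ⊥
      no-escape with em {∃[ k ] g ≈ᴹ k *ₗ y}
      ... | no g∦y = no-fundamentals g∦y
        (proj₂ (proj₂ (fundamentals Y (plane-twoDimensional {X} g∈X y∈X (nonzero y∈X) g∦y))))
      -- The plane collapses to a line, so the argument by rays replaces the one by fundamental
      -- vectors.
      ... | yes (k , g≈ky) with collinear (nonzero z∈X) g≈ky z∈cone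
      ...   | inj₁ z∈yy = disjoint (S-closed y∈Z y∈Z z∈Z y∈S y∈S z∈yy) z∈T
      ...   | inj₂ g∈zz = g∉cone z∈Z z∈Z z∈T z∈T g∈zz

    private
      Z⁺ : Subset ℝ V
      Z⁺ = initial (ℕ.suc (position j))

      replaceˡ : ∀ {x x′ y z} → x ≈ᴹ x′ → z ∈ Cone x y → z ∈ Cone x′ y
      replaceˡ {x′ = x′} {y} x≈x′ =
        cone-mono (cone-left y x≈x′) (cone-right x′ ≈ᴹ-refl)

    S-closed⁺ : ClosedIn Z⁺ S
    S-closed⁺ {x} {y} {z} x∈ y∈ z∈ x∈S y∈S z∈cone with cover z
    ... | inj₁ z∈S = z∈S
    ... | inj₂ z∈T with initial-suc j z∈
    ...   | inj₂ z≈g = respˡ (≈ᴹ-sym z≈g) g∈S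
    ...   | inj₁ z∈Z with initial-suc j x∈ | initial-suc j y∈
    ...     | inj₁ x∈Z | inj₁ y∈Z = S-closed x∈Z y∈Z z∈Z x∈S y∈S z∈cone
    ...     | inj₂ x≈g | inj₁ y∈Z = ⊥-elim
      (no-escape y∈Z z∈Z y∈S z∈T (replaceˡ x≈g z∈cone))
    ...     | inj₁ x∈Z | inj₂ y≈g = ⊥-elim
      (no-escape x∈Z z∈Z x∈S z∈T (replaceˡ y≈g (cone-swap z∈cone)))
    -- Now `z` is on the ray of `g`, hence `g` is on the ray of `z`, which is in `T`.
    ...     | inj₂ x≈g | inj₂ y≈g = ⊥-elim (g∉cone z∈Z z∈Z z∈T z∈T
      (cone-invert (nonzero (initial⊆X z∈Z))
        (cone-mono (cone-left g x≈g) (cone-left g y≈g) z∈cone)))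

    -- Since `g` is in `S`, the generators `x` and `y` are old. The only new case is `z` being `g`,
    -- which `g∉cone` excludes.
    T-closed⁺ : ClosedIn Z⁺ T
    T-closed⁺ x∈ y∈ z∈ x∈T y∈T z∈cone
      with initial-suc j x∈ | initial-suc j y∈ | initial-suc j z∈
    ... | inj₂ x≈g | _        | _        = ⊥-elim (disjoint g∈S (respʳ x≈g x∈T))
    ... | inj₁ _   | inj₂ y≈g | _        = ⊥-elim (disjoint g∈S (respʳ y≈g y∈T))
    ... | inj₁ x∈Z | inj₁ y∈Z | inj₁ z∈Z = T-closed x∈Z y∈Z z∈Z x∈T y∈T z∈cone
    ... | inj₁ x∈Z | inj₁ y∈Z | inj₂ z≈g =
      ⊥-elim (g∉cone x∈Z y∈Z x∈T y∈T (cone-resp (≈ᴹ-sym z≈g) z∈cone))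

  -- Choose a full `F` around `a`, `b`, `c` with clean trace on the segment. The trace of `S` is
  -- biclosed there, so weak separability would force `g` to be zero.
  cones-disjoint : ∀ {S T i a b c d g} → Partition S T →
    ClosedIn (initial i) S → ClosedIn (initial i) T →
    a ∈ initial i → b ∈ initial i → c ∈ initial i → d ∈ initial i →
    a ∈ S → b ∈ S → c ∈ T → d ∈ T → g ∈ X → g ∈ Cone a b → g ∉ Cone c d
  cones-disjoint {S} {T} {i} {a} {b} {c} {d} {g} P S-closed T-closed
                 a∈Z b∈Z c∈Z d∈Z a∈S b∈S c∈T d∈T g∈X g∈ab g∈cd
    with proj₂ suitable i a b c a∈Z b∈Z c∈Z
  ... | F , (F⊆X , F-full) , a∈F , b∈F , c∈F , F∩Z-clean =
    nonzero g∈X (proj₁ (F∩Z-clean S′ S′-biclosed)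
      ( cone⇒span₊ {S′} (a∈S , a∈F , a∈Z) (b∈S , b∈F , b∈Z) g∈ab
      , g∈Span₊[Y∖S′] g∈cd))
    where
    open Partition P

    Y S′ : Subset ℝ V
    Y = F ∩ initial i
    S′ = S ∩ Y

    span⊆F : ∀ {α β} → α ∈ F → β ∈ F → X ∩ Plane α β ⊆ F
    span⊆F {α} {β} α∈F β∈F (v∈X , v∈plane) = proj₁
      (proj₂ (F-full α β α∈F β∈F) (v∈X ,
        plane⇒span {｛_⨾_｝ ℝ V α β} (inj₁ ≈ᴹ-refl) (inj₂ ≈ᴹ-refl) v∈plane))

    g∈F : g ∈ F
    g∈F = span⊆F a∈F b∈F (g∈X , cone⇒plane g∈ab)

    S′-biclosed : Biclosed ℝ V Y S′
    S′-biclosed =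
      (proj₂ , λ _ _ _ (α∈S , _ , α∈Z) (β∈S , _ , β∈Z) (v∈ , v∈F , v∈Z) →
        S-closed α∈Z β∈Z v∈Z α∈S β∈S (span₊⇒cone v∈) , v∈F , v∈Z) ,
      proj₂ , proj₁ , λ α β v (α∈Y , α∉S′) (β∈Y , β∉S′) (v∈ , v∈Y) →
        v∈Y , λ (v∈S , _) → disjoint v∈S
          (T-closed (proj₂ α∈Y) (proj₂ β∈Y) (proj₂ v∈Y)
            (outside α∈Y α∉S′) (outside β∈Y β∉S′) (span₊⇒cone v∈))
      where
      outside : ∀ {v} → v ∈ Y → v ∉ S′ → v ∈ T
      outside {v} v∈Y v∉S′ with cover v
      ... | inj₁ v∈S = contradiction (v∈S , v∈Y) v∉S′
      ... | inj₂ v∈T = v∈T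

    c∈Y∖S′ : c ∈ Y ∖ S′
    c∈Y∖S′ = (c∈F , c∈Z) , λ (c∈S , _) → disjoint c∈S c∈T

    -- `F` was chosen around three vectors only, so `d` must be recovered. If its coefficient `t` is
    -- nonzero, `d` lies in the plane of `g` and `c`, and fullness puts it in `F`. If `t` is zero,
    -- `g` is a multiple of `c`, and `c` serves as both generators.
    g∈Span₊[Y∖S′] : g ∈ Cone c d → g ∈ Span₊ ℝ V (Y ∖ S′)
    g∈Span₊[Y∖S′] g∈cd@(s , t , 0≤s , 0≤t , g≈) with em {t ≈ 0#}
    ... | yes t≈0 = cone⇒span₊ {Y ∖ S′} c∈Y∖S′ c∈Y∖S′
      (s , t , 0≤s , 0≤t , ≈ᴹ-trans g≈ (+ᴹ-congˡ
        (≈ᴹ-trans (≈ᴹ-trans (*ₗ-cong t≈0 ≈ᴹ-refl) (*ₗ-zeroˡ d))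
          (≈ᴹ-sym (≈ᴹ-trans (*ₗ-cong t≈0 ≈ᴹ-refl) (*ₗ-zeroˡ c))))))
    ... | no t≉0 = cone⇒span₊ {Y ∖ S′} c∈Y∖S′
      ((d∈F , d∈Z) , λ (d∈S , _) → disjoint d∈S d∈T) g∈cd
      where
      d∈F : d ∈ F
      d∈F = span⊆F g∈F c∈F
        (initial⊆X d∈Z , isolate t≉0 (≈ᴹ-trans g≈ (+ᴹ-comm _ _)))

  -- The set built from `U` and its identification with the closure.

  module Construction (m : ℕ) (U : Subset ℝ V) (U-coclosed : Coclosed ℝ V (initial m) U) where

    -- `forced` refers to earlier positions only, unlike `Generated`; this makes induction along the
    -- ordering possible. `given` accepts any representative of `vector j`, so membership in `U`
    -- need not be transported along `_≈ᴹ_`.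
    data Chosen (j : Index length) : Set ℓ where
      given  : ∀ {v} → v ≈ᴹ vector j → v ∈ U → Chosen j
      forced : ∀ {a b} → Chosen a → Chosen b →
               position a ℕ.< position j → position b ℕ.< position j →
               vector j ∈ Cone (vector a) (vector b) → Chosen j

    B : Subset ℝ V
    B v = ∃[ j ] v ≈ᴹ vector j × Chosen j

    U⊆B : U ⊆ B
    U⊆B v∈U with proj₁ U-coclosed v∈U
    ... | j , _ , v≈ = j , v≈ , given v≈ v∈U

    chosen : ∀ {j} → vector j ∈ B → Chosen j
    chosen {j} (k , j≈k , k-chosen) with injective j k j≈k
    ... | ≡.refl = k-chosen

    B-partition : Partition B (∁ B)
    B-partition = record
      { cover = cover ; disjoint = λ v∈B v∉B → v∉B v∈B
      ; respˡ = resp ; respʳ = λ v≈w v∉B → v∉B ∘ resp (≈ᴹ-sym v≈w) }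
      where
      resp : B Respects _≈ᴹ_
      resp v≈w (j , v≈ , j-chosen) = j , ≈ᴹ-trans (≈ᴹ-sym v≈w) v≈ , j-chosen

      cover : ∀ v → v ∈ B ⊎ v ∉ B
      cover v with em {v ∈ B}
      ... | yes v∈B = inj₁ v∈B
      ... | no  v∉B = inj₂ v∉B

    B∩initial : ∀ {i v} → v ∈ initial i → v ∈ B →
                ∃[ j ] v ≈ᴹ vector j × position j ℕ.< i × Chosen j
    B∩initial (j , j<i , v≈j) (k , v≈k , k-chosen)
      with injective j k (≈ᴹ-trans (≈ᴹ-sym v≈j) v≈k)
    ... | ≡.refl = j , v≈j , j<i , k-chosen

    B-closed-initial : ∀ i → ClosedIn (initial i) B × ClosedIn (initial i) (∁ B)
    B-closed-initial zero =
      (λ { (_ , () , _) }) , (λ { (_ , () , _) })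
    -- A finite ordering may have no vector at position `i`; the segment then does not grow. `Lift`
    -- brings the question to the level of `em`.
    B-closed-initial (ℕ.suc i) with em {Lift ℓ (∃[ j ] position {length} j ≡ i)}
    ... | no i∉ = Product.map restrict restrict (B-closed-initial i)
      where
      shrink : initial (ℕ.suc i) ⊆ initial i
      shrink (j , j<1+i , v≈) with ℕ.m≤n⇒m<n∨m≡n (s≤s⁻¹ j<1+i)
      ... | inj₁ j<i = j , j<i , v≈
      ... | inj₂ j≡i = contradiction (lift (j , j≡i)) i∉

      restrict : ∀ {S} → ClosedIn (initial i) S → ClosedIn (initial (ℕ.suc i)) S
      restrict S-closed x∈ y∈ z∈ = S-closed (shrink x∈) (shrink y∈) (shrink z∈)
    ... | yes (lift (j , ≡.refl)) with B-closed-initial i | em {vector j ∈ B}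
    ...   | B-closed , ∁B-closed | yes j∈B = I.S-closed⁺ , I.T-closed⁺
      where
      g∉cone : ∀ {c d} → Chosen j → c ∈ initial i → d ∈ initial i →
               c ∉ B → d ∉ B → vector j ∉ Cone c d
      g∉cone (given v≈ v∈U) c∈Z d∈Z c∉B d∉B g∈cone
        with proj₁ U-coclosed v∈U
      ... | k , k<m , v≈k with injective j k (≈ᴹ-trans (≈ᴹ-sym v≈) v≈k)
      ...   | ≡.refl = proj₂ (proj₂ (proj₂ U-coclosed) _ _ _
        -- `c` and `d` precede position `j`, which is below `m`, so both lie in the segment in which
        -- `U` is coclosed.
        (initial-mono (ℕ.<⇒≤ k<m) c∈Z , c∉B ∘ U⊆B)
        (initial-mono (ℕ.<⇒≤ k<m) d∈Z , d∉B ∘ U⊆B)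
        (cone⇒span₊-pair (cone-resp v≈ g∈cone) , k , k<m , v≈k))
        v∈U
      g∉cone (forced {a} {b} a-chosen b-chosen a<j b<j j∈ab) c∈Z d∈Z c∉B d∉B =
        cones-disjoint B-partition B-closed ∁B-closed
          (a , a<j , ≈ᴹ-refl) (b , b<j , ≈ᴹ-refl) c∈Z d∈Z
          (a , ≈ᴹ-refl , a-chosen) (b , ≈ᴹ-refl , b-chosen) c∉B d∉B
          (vector∈X j ≈ᴹ-refl) j∈ab

      module I = Insertion B-partition j B-closed ∁B-closed j∈B (g∉cone (chosen j∈B))
    ...   | B-closed , ∁B-closed | no j∉B = I.T-closed⁺ , I.S-closed⁺
      where
      g∉cone : ∀ {c d} → c ∈ initial i → d ∈ initial i →
               c ∈ B → d ∈ B → vector j ∉ Cone c d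
      g∉cone c∈Z d∈Z c∈B d∈B g∈cone
        with B∩initial c∈Z c∈B | B∩initial d∈Z d∈B
      -- Two earlier chosen vectors with `vector j` in their cone would have forced `j` to be
      -- chosen.
      ... | a , c≈a , a<j , a-chosen | b , d≈b , b<j , b-chosen = j∉B
        (j , ≈ᴹ-refl , forced a-chosen b-chosen a<j b<j
          (cone-mono (cone-left _ c≈a) (cone-right _ d≈b) g∈cone))

      module I = Insertion (flip-partition B-partition) j ∁B-closed B-closed j∉B g∉cone

    -- Closedness involves three vectors at a time, and these share an initial segment, of size one
    -- more than their largest position.
    initial-exhausts : ∀ {S} → (∀ i → ClosedIn (initial i) S) → ClosedIn X S
    initial-exhausts closed x∈X y∈X z∈X with index x∈X | index y∈X | index z∈X
    ... | j , x≈ | k , y≈ | l , z≈ = closed (ℕ.suc (p ℕ.⊔ q ℕ.⊔ r))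
      (j , s≤s (ℕ.≤-trans (ℕ.m≤m⊔n p q) (ℕ.m≤m⊔n (p ℕ.⊔ q) r)) , x≈)
      (k , s≤s (ℕ.≤-trans (ℕ.m≤n⊔m p q) (ℕ.m≤m⊔n (p ℕ.⊔ q) r)) , y≈)
      (l , s≤s (ℕ.m≤n⊔m (p ℕ.⊔ q) r) , z≈)
      where
      p = position j
      q = position k
      r = position l

    B⊆X : B ⊆ X
    B⊆X (j , v≈ , _) = vector∈X j v≈

    B-closed : ClosedIn X B
    B-closed = initial-exhausts (proj₁ ∘ B-closed-initial)

    ∁B-closed : ClosedIn X (∁ B)
    ∁B-closed = initial-exhausts (proj₂ ∘ B-closed-initial)

    B⊆closure : ∀ {Ū} → IsClosure ℝ V X U Ū → B ⊆ Ū
    B⊆closure {Ū} Ū-closure (j , v≈ , j-chosen) = chosen⇒∈ v≈ j-chosen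
      where
      open IsClosure Ū-closure
      chosen⇒∈ : ∀ {j v} → v ≈ᴹ vector j → Chosen j → v ∈ Ū
      -- `Ū` is not assumed to respect `_≈ᴹ_`; closedness applied to the pair `w`, `w` carries
      -- membership from `w` to `v`.
      chosen⇒∈ {j} v≈ (given {w} w≈ w∈U) = proj₂ closed w w _
        (contains w∈U) (contains w∈U)
        (cone⇒span₊-pair
          (cone-left w (≈ᴹ-trans v≈ (≈ᴹ-sym w≈))) , vector∈X j v≈)
      chosen⇒∈ {j} v≈ (forced {a} {b} a-chosen b-chosen _ _ j∈ab) =
        proj₂ closed (vector a) (vector b) _
          (chosen⇒∈ ≈ᴹ-refl a-chosen) (chosen⇒∈ ≈ᴹ-refl b-chosen)
          (cone⇒span₊-pair (cone-resp v≈ j∈ab) , vector∈X j v≈)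

    closure⊆B : ∀ {Ū} → IsClosure ℝ V X U Ū → Ū ⊆ B
    closure⊆B Ū-closure = IsClosure.smallest Ū-closure B U⊆B
      (B⊆X , λ _ _ _ α∈B β∈B (v∈ , v∈X) →
        B-closed (B⊆X α∈B) (B⊆X β∈B) v∈X α∈B β∈B (span₊⇒cone v∈))

    -- `Ū` and `B` have the same elements. Closedness is part of being a closure, and coclosedness
    -- is carried over from `∁ B` through the two inclusions.
    closure-biclosed : ∀ {Ū} → IsClosure ℝ V X U Ū → Biclosed ℝ V X Ū
    closure-biclosed Ū-closure =
      closed , proj₁ closed , proj₁ ,
      λ _ _ _ (α∈X , α∉Ū) (β∈X , β∉Ū) (v∈ , v∈X) → v∈X ,
        ∁B-closed α∈X β∈X v∈X (α∉Ū ∘ B⊆Ū) (β∉Ū ∘ B⊆Ū) (span₊⇒cone v∈)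
          ∘ closure⊆B Ū-closure
      where
      open IsClosure Ū-closure using (closed)
      B⊆Ū = B⊆closure Ū-closure

theorem3p1 :
    ∀ {ℓ : Level} → ExcludedMiddle (suc ℓ) →
    (ℝ : RealField ℓ) (V : Module (RealField.commutativeRing ℝ) ℓ ℓ) →
    FiniteDimensional ℝ V →
    (X : Subset ℝ V) → Module.0ᴹ V ∉ X →
    (∀ Y → TwoDimensionalLinearSubset ℝ V X Y → HasFundamentalVectors ℝ V Y) →
    (γ : Ordering ℝ V X) → Suitable ℝ V γ →
    (m : ℕ) (U : Subset ℝ V) → Coclosed ℝ V (Ordering.initial γ m) U →
    (Ū : Subset ℝ V) → IsClosure ℝ V X U Ū →
    Biclosed ℝ V X Ū
theorem3p1 {ℓ} em ℝ V _ X 0∉X fundamentals γ suitable m U U-coclosed Ū =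
  Separations.Construction.closure-biclosed em′ ℝ V X 0∉X fundamentals γ suitable
    m U U-coclosed
  where
  em′ : ExcludedMiddle ℓ
  em′ {A} = map′ lower lift (em {Lift (suc ℓ) A})
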